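{- Let $\mathcal{H}$ be a pseudohalfplane hypergraph on a finite totally ordered vertex set $V$ with $|V|=n\ge 3$. If every subset of $3$ vertices of $V$ is contained in some hyperedge $H\in\mathcal{H}$, then there exist at most two hyperedges of $\mathcal{H}$ whose union is $V$.
   Context: A hypergraph $\mathcal{F}$ on a totally ordered finite vertex set $V$ (a family of subsets of $V$) is ABA-free if there are no two hyperedges $A,B\in\mathcal{F}$ and vertices $x<y<z$ with $x,z\in A\setminus B$ and $y\in B\setminus A$. For a family $\mathcal{F}$ of subsets of $V$ let $\bar{\mathcal{F}}=\{V\setminus F: F\in\mathcal{F}\}$. A hypergraph $\mathcal{H}$ on $V$ is a pseudohalfplane hypergraph if there exists an ABA-free hypergraph $\mathcal{F}$ on $V$ such that $\mathcal{H}\subseteq\mathcal{F}\cup\bar{\mathcal{F}}$. -}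

module Defs where

open import Data.Nat using (ℕ)
open import Data.Fin using (Fin; _<_)
open import Data.Fin.Subset using (Subset; _∈_; _∉_; ∁)
open import Data.List using (List)
import Data.List.Membership.Propositional as L
open import Data.Product using (∃; _×_)
open import Data.Sum using (_⊎_)
open import Data.Empty using (⊥)

-- A hypergraph on the totally ordered vertex set V = Fin n (natural order)
-- is a finite family of subsets, given as a list.
Hypergraph : ℕ → Set
Hypergraph n = List (Subset n)

ABAFree : ∀ {n} → Hypergraph n → Set
ABAFree {n} 𝓕 =
  ∀ {A B} → A L.∈ 𝓕 → B L.∈ 𝓕 →
  ∀ {x y z : Fin n} → x < y → y < z →
  x ∈ A → x ∉ B → z ∈ A → z ∉ B → y ∈ B → y ∉ A → ⊥

PseudoHalfplane : ∀ {n} → Hypergraph n → Set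
PseudoHalfplane {n} ℋ =
  ∃ λ (𝓕 : Hypergraph n) → ABAFree 𝓕 ×
    (∀ {H} → H L.∈ ℋ → H L.∈ 𝓕 ⊎ ∃ λ F → F L.∈ 𝓕 × H ≡ ∁ F)
  where open import Relation.Binary.PropositionalEquality using (_≡_)

{-# OPTIONS --safe #-}
-- Passing to complements, it suffices to hit a pairwise intersecting family 𝒦 of
-- pseudohalfplanes by three vertices.  Take the first vertex as one of them.  If some
-- member of 𝒦 avoids the first and the last vertex we may assume, by complementing 𝓕,
-- that it lies in 𝓕.  Call a vertex skippable if some member of 𝓕 has elements on both
-- sides of it but does not contain it; the unskippable vertices play the role of the
-- upper convex hull.  Among the members of 𝒦 ∩ 𝓕 avoiding the first and last vertex,
-- choose one whose rightmost unskippable vertex r is leftmost, and let q be the next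
-- unskippable vertex after r.  Then the first vertex, r and q hit all of 𝒦.
module Submission where

open import Defs
open import Data.Bool using () renaming (_≟_ to _≟ᵇ_)
open import Data.Empty using (⊥; ⊥-elim)
open import Data.Nat using (ℕ; _+_; _≥_; z≤n; s≤s)
import Data.Nat.Properties as ℕ
open import Data.Fin using (Fin; zero; suc; fromℕ; _<_)
open import Data.Fin.Properties
  using (any?; all?; _<?_; <-cmp; <-trans; ≤fromℕ; ≤∧≢⇒<; ¬∀⟶∃¬)
open import Data.Fin.Induction using (<-wellFounded; >-wellFounded)
open import Data.Fin.Subset using (Subset; Nonempty; _∈_; _∉_; _⊆_; _⊂_; _∪_; ⊤; ∁)
open import Data.Fin.Subset.Properties
  using (_∈?_; x∈p⇒x∉∁p; x∈∁p⇒x∉p; x∉∁p⇒x∈p; x∉p⇒x∈∁p; x∈p∪q⁺; ⊆⊤; ⊆-antisym)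
open import Data.Fin.Subset.Induction using (⊂-wellFounded)
open import Data.List using (map)
import Data.List.Membership.Propositional as L
open import Data.List.Membership.Propositional.Properties using (∈-map⁺; ∈-map⁻)
import Data.List.Membership.DecPropositional as DecMembership
open import Data.List.Relation.Unary.Any using (Any) renaming (any? to anyL?)
open import Data.Product using (∃; ∃₂; _×_; _,_; proj₁; proj₂)
open import Data.Sum using (_⊎_; inj₁; inj₂; [_,_]′)
open import Data.Vec.Properties using (≡-dec)
open import Function using (_∘_; flip)
open import Induction.WellFounded using (WellFounded; Acc; acc)
open import Relation.Binary.Definitions using (tri<; tri≈; tri>) renaming (Decidable to Decidable₂)
open import Relation.Binary.PropositionalEquality using (_≡_; _≢_; refl; sym; subst)
open import Relation.Nullary using (¬_; yes; no; contradiction)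
open import Relation.Nullary.Decidable using (_×-dec_; _→-dec_; ¬?; decidable-stable)
open import Relation.Unary using (Decidable)

private
  variable
    n : ℕ

  _≟ˢ_ : Decidable₂ {A = Subset n} _≡_
  _≟ˢ_ = ≡-dec _≟ᵇ_

-- Extremal vertices of decidable properties

minimal : {R : Fin n → Fin n → Set} → WellFounded R → Decidable₂ R →
  {P : Fin n → Set} → Decidable P → ∃ P → ∃ λ v → P v × (∀ {u} → R u v → ¬ P u)
minimal {R = R} wf R? {P} P? (v , Pv) = go v (wf v) Pv
  where
  go : ∀ v → Acc R v → P v → ∃ λ v → P v × (∀ {u} → R u v → ¬ P u)
  go v (acc rec) Pv with any? (λ u → R? u v ×-dec P? u)
  ... | yes (u , Ruv , Pu) = go u (rec Ruv) Pu
  ... | no none = v , Pv , λ Ruv Pu → none (_ , Ruv , Pu)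

first : {P : Fin n → Set} → Decidable P → ∃ P → ∃ λ v → P v × (∀ {u} → u < v → ¬ P u)
first = minimal <-wellFounded _<?_

last : {P : Fin n → Set} → Decidable P → ∃ P → ∃ λ v → P v × (∀ {u} → v < u → ¬ P u)
last = minimal >-wellFounded (flip _<?_)

-- Skippable vertices and the discrete hull

Skips : Subset n → Fin n → Set
Skips B v = v ∉ B × (∃ λ x → x < v × x ∈ B) × (∃ λ y → v < y × y ∈ B)

skips? : (B : Subset n) → Decidable (Skips B)
skips? B v = ¬? (v ∈? B) ×-dec any? (λ x → x <? v ×-dec x ∈? B)
                         ×-dec any? (λ y → v <? y ×-dec y ∈? B)

Skippable : Hypergraph n → Fin n → Set
Skippable 𝓕 v = Any (λ B → Skips B v) 𝓕

skippable? : (𝓕 : Hypergraph n) → Decidable (Skippable 𝓕)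
skippable? 𝓕 v = anyL? (λ B → skips? B v) 𝓕

fromℕ-unskippable : (𝓕 : Hypergraph (ℕ.suc n)) → ¬ Skippable 𝓕 (fromℕ n)
fromℕ-unskippable 𝓕 s with L.find s
... | _ , _ , _ , _ , y , last<y , _ = ℕ.<⇒≱ last<y (≤fromℕ y)

module _ {𝓕 : Hypergraph n} (aba : ABAFree 𝓕) where

  -- If no unskippable vertex lies in A, nor (inductively) in a smaller member of 𝓕, then
  -- each v ∈ A is skipped by a set having an element outside A, to the left or to the
  -- right of v.  By induction on v, the former can always be achieved.  Such a set
  -- continues inside A to the right of v, so A has no last element.
  contains-unskippable : ∀ {A} → A L.∈ 𝓕 → Nonempty A → ∃ λ v → v ∈ A × ¬ Skippable 𝓕 v
  contains-unskippable {A} A∈ ne = go A (⊂-wellFounded A) A∈ ne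
    where
    go : ∀ A → Acc _⊂_ A → A L.∈ 𝓕 → Nonempty A → ∃ λ v → v ∈ A × ¬ Skippable 𝓕 v
    go A (acc rec) A∈ ne with any? (λ v → v ∈? A ×-dec ¬? (skippable? 𝓕 v))
    ... | yes found = found
    ... | no none = ⊥-elim absurd
      where
      LeftSkipped RightSkipped : Fin n → Set
      LeftSkipped v = ∃ λ B → B L.∈ 𝓕 × v ∉ B ×
        (∃ λ w → w < v × w ∈ B × w ∉ A) × (∃ λ y → v < y × y ∈ B)
      RightSkipped v = ∃ λ B → B L.∈ 𝓕 × v ∉ B ×
        (∃ λ x → x < v × x ∈ B) × (∃ λ w → v < w × w ∈ B × w ∉ A)

      ⊈A : ∀ {B v} → B L.∈ 𝓕 → Nonempty B → v ∈ A → v ∉ B → ∃ λ w → w ∈ B × w ∉ A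
      ⊈A {B} B∈ neB v∈A v∉B with any? (λ w → w ∈? B ×-dec ¬? (w ∈? A))
      ... | yes found = found
      -- Otherwise `B` lies in `A`, strictly because it misses `v`, so by induction `B` has an
      -- unskippable vertex, which is then one of `A` as well.
      ... | no none′ = ⊥-elim (none (u , B⊆A u∈B , unskippable))
        where
        B⊆A : B ⊆ A
        B⊆A {w} w∈B = decidable-stable (w ∈? A) λ w∉A → none′ (w , w∈B , w∉A)
        r = go B (rec (B⊆A , _ , v∈A , v∉B)) B∈ neB
        u = proj₁ r
        u∈B = proj₁ (proj₂ r)
        unskippable = proj₂ (proj₂ r)

      skipped : ∀ {v} → v ∈ A → LeftSkipped v ⊎ RightSkipped v
      skipped {v} v∈A
        with L.find (decidable-stable (skippable? 𝓕 v) λ ns → none (v , v∈A , ns))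
      ... | B , B∈ , v∉B , left@(x , _ , x∈B) , right
        with ⊈A B∈ (x , x∈B) v∈A v∉B
      ... | w , w∈B , w∉A with <-cmp w v
      ... | tri< w<v _ _ = inj₁ (B , B∈ , v∉B , (w , w<v , w∈B , w∉A) , right)
      ... | tri≈ _ refl _ = contradiction v∈A w∉A
      ... | tri> _ _ v<w = inj₂ (B , B∈ , v∉B , left , (w , v<w , w∈B , w∉A))

      leftSkipped : ∀ v → Acc _<_ v → v ∈ A → LeftSkipped v
      leftSkipped v (acc recv) v∈A with skipped v∈A
      ... | inj₁ l = l
      ... | inj₂ (C , C∈ , v∉C , (x , x<v , x∈C) , w , v<w , w∈C , w∉A)
        -- `c` is the last element of `C` before `v`. ABA-freeness of `C` and `A` puts `c` in `A`,
        -- so induction gives an `E` skipping `c`. Comparing `E` with `C` around `c` forces `v` out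
        -- of `E` and `y` into `C`; as `C` has no element from just after `c` up to `v`, `y` lies
        -- beyond `v`.
        with last (λ c → c <? v ×-dec c ∈? C) (x , x<v , x∈C)
      ... | c , (c<v , c∈C) , c-last
        with leftSkipped c (recv c<v) c∈A
        where
        c∈A : c ∈ A
        c∈A = decidable-stable (c ∈? A) λ c∉A → aba C∈ A∈ c<v v<w c∈C c∉A w∈C w∉A v∈A v∉C
      ... | E , E∈ , c∉E , (w′ , w′<c , w′∈E , w′∉A) , y , c<y , y∈E
        = E , E∈ , v∉E , (w′ , w′<v , w′∈E , w′∉A) , y , v<y , y∈E
        where
        w′<v = <-trans w′<c c<v
        w′∉C : w′ ∉ C
        w′∉C w′∈C = aba C∈ A∈ w′<v v<w w′∈C w′∉A w∈C w∉A v∈A v∉C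
        y∈C : y ∈ C
        y∈C = decidable-stable (y ∈? C) λ y∉C →
          aba E∈ C∈ w′<c c<y w′∈E w′∉C y∈E y∉C c∈C c∉E
        v<y : v < y
        v<y with <-cmp v y
        ... | tri< v<y _ _ = v<y
        ... | tri≈ _ refl _ = contradiction y∈C v∉C
        ... | tri> _ _ y<v = contradiction (y<v , y∈C) (c-last c<y)
        v∉E : v ∉ E
        v∉E v∈E = aba E∈ C∈ w′<c c<v w′∈E w′∉C v∈E v∉C c∈C c∉E

      absurd : ⊥
      absurd with last (_∈? A) ne
      ... | m , m∈A , m-last with leftSkipped m (<-wellFounded m) m∈A
      ... | E , E∈ , m∉E , (w , w<m , w∈E , w∉A) , y , m<y , y∈E =
        aba E∈ A∈ w<m m<y w∈E w∉A y∈E (m-last m<y) m∈A m∉E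

RightmostUnskippable : Hypergraph n → Subset n → Fin n → Set
RightmostUnskippable 𝓕 A r = (r ∈ A × ¬ Skippable 𝓕 r) ×
  (∀ u → r < u → ¬ (u ∈ A × ¬ Skippable 𝓕 u))

rightmostUnskippable? : (𝓕 : Hypergraph n) (A : Subset n) → Decidable (RightmostUnskippable 𝓕 A)
rightmostUnskippable? 𝓕 A r = hull? r ×-dec all? λ u → r <? u →-dec ¬? (hull? u)
  where
  hull? : Decidable (λ u → u ∈ A × ¬ Skippable 𝓕 u)
  hull? u = u ∈? A ×-dec ¬? (skippable? 𝓕 u)

rightmostUnskippable : {𝓕 : Hypergraph n} → ABAFree 𝓕 → ∀ {A} → A L.∈ 𝓕 → Nonempty A →
  ∃ (RightmostUnskippable 𝓕 A)
rightmostUnskippable {𝓕 = 𝓕} aba {A} A∈ ne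
  with last (λ u → u ∈? A ×-dec ¬? (skippable? 𝓕 u)) (contains-unskippable aba A∈ ne)
... | r , hull , r-last = r , hull , λ u r<u → r-last r<u

-- Hitting pairwise intersecting families with three vertices

PairwiseIntersecting : Hypergraph n → Set
PairwiseIntersecting 𝒦 = ∀ {A B} → A L.∈ 𝒦 → B L.∈ 𝒦 → ∃ λ p → p ∈ A × p ∈ B

Hits : Fin n → Fin n → Fin n → Hypergraph n → Set
Hits x y z 𝒦 = ∀ {K} → K L.∈ 𝒦 → x ∉ K → y ∉ K → z ∉ K → ⊥

module _ {m : ℕ} {𝓕 𝒦 : Hypergraph (ℕ.suc m)} (aba : ABAFree 𝓕)
         (halfplane : ∀ {K} → K L.∈ 𝒦 → K L.∈ 𝓕 ⊎ ∁ K L.∈ 𝓕)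
         (intersecting : PairwiseIntersecting 𝒦) where

  private
    Inner : Subset (ℕ.suc m) → Set
    Inner A = A L.∈ 𝓕 × zero ∉ A × fromℕ m ∉ A

    inner? : Decidable Inner
    inner? A = A ∈𝓕? ×-dec ¬? (zero ∈? A) ×-dec ¬? (fromℕ m ∈? A)
      where
      _∈𝓕? : Decidable (L._∈ 𝓕)
      A ∈𝓕? = DecMembership._∈?_ _≟ˢ_ A 𝓕

    InnerEnd : Fin (ℕ.suc m) → Set
    InnerEnd r = Any (λ A → Inner A × RightmostUnskippable 𝓕 A r) 𝒦

    innerEnd? : Decidable InnerEnd
    innerEnd? r = anyL? (λ A → inner? A ×-dec rightmostUnskippable? 𝓕 A r) 𝒦

  three-hit-of-inner : ∀ {A} → A L.∈ 𝒦 → A L.∈ 𝓕 → zero ∉ A → fromℕ m ∉ A →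
    ∃₂ λ r q → zero {m} < r × r < q × Hits zero r q 𝒦
  three-hit-of-inner A₀∈𝒦 A₀∈𝓕 0∉A₀ last∉A₀
    with first innerEnd? (_ , L.lose A₀∈𝒦 ((A₀∈𝓕 , 0∉A₀ , last∉A₀) , proj₂ end))
    where
    p = intersecting A₀∈𝒦 A₀∈𝒦
    end = rightmostUnskippable aba A₀∈𝓕 (proj₁ p , proj₁ (proj₂ p))
  ... | r , inner , r-first with L.find inner
  ... | A , A∈𝒦 , (A∈𝓕 , 0∉A , last∉A) , (r∈A , r-unskippable) , r-rightmost
    -- The last vertex is unskippable and lies beyond `r`, so a next unskippable vertex exists.
    with first (λ q → r <? q ×-dec ¬? (skippable? 𝓕 q))
               (fromℕ m , r<last , fromℕ-unskippable 𝓕)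
    where
    r<last : r < fromℕ m
    r<last = ≤∧≢⇒< (≤fromℕ r) λ { refl → last∉A r∈A }
  ... | q , (r<q , q-unskippable) , q-first = r , q , 0<r , r<q , hits
    where
    0<r : zero {m} < r
    0<r = ≤∧≢⇒< z≤n λ { refl → 0∉A r∈A }

    q∉A : q ∉ A
    q∉A q∈A = r-rightmost q r<q (q∈A , q-unskippable)

    A<q : ∀ {p} → p ∈ A → p < q
    A<q {p} p∈A with <-cmp p q
    ... | tri< p<q _ _ = p<q
    ... | tri≈ _ refl _ = contradiction p∈A q∉A
    ... | tri> _ _ q<p = contradiction
      (L.lose A∈𝓕 (q∉A , (r , r<q , r∈A) , (p , q<p , p∈A))) q-unskippable

    hits : Hits zero r q 𝒦
    hits {K} K∈𝒦 0∉K r∉K q∉K with intersecting A∈𝒦 K∈𝒦 | halfplane K∈𝒦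
    -- `zero` and `q` lie in `∁ K` but not in `A`, while `p` between them lies in `A` but not in
    -- `∁ K`: a forbidden pattern.
    ... | p , p∈A , p∈K | inj₂ ∁K∈𝓕 =
      aba ∁K∈𝓕 A∈𝓕 0<p (A<q p∈A) (x∉p⇒x∈∁p 0∉K) 0∉A (x∉p⇒x∈∁p q∉K) q∉A p∈A (x∈p⇒x∉∁p p∈K)
      where
      0<p : zero {m} < p
      0<p = ≤∧≢⇒< z≤n λ { refl → 0∉A p∈A }
    -- Since `K` contains `p` before `q` and cannot skip `q`, it stays left of `q`. No unskippable
    -- vertex lies strictly between `r` and `q`, and `K` misses `r`, so its rightmost one precedes
    -- `r`, against the choice of `r`.
    ... | p , p∈A , p∈K | inj₁ K∈𝓕 with rightmostUnskippable aba K∈𝓕 (p , p∈K)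
    ... | s , end@((s∈K , s-unskippable) , _) =
      r-first s<r (L.lose K∈𝒦 ((K∈𝓕 , 0∉K , last∉K) , end))
      where
      K<q : ∀ {y} → y ∈ K → y < q
      K<q {y} y∈K with <-cmp y q
      ... | tri< y<q _ _ = y<q
      ... | tri≈ _ refl _ = contradiction y∈K q∉K
      ... | tri> _ _ q<y = contradiction
        (L.lose K∈𝓕 (q∉K , (p , A<q p∈A , p∈K) , (y , q<y , y∈K))) q-unskippable

      last∉K : fromℕ m ∉ K
      last∉K last∈K = ℕ.<⇒≱ (K<q last∈K) (≤fromℕ q)

      s<r : s < r
      s<r with <-cmp s r
      ... | tri< s<r _ _ = s<r
      ... | tri≈ _ refl _ = contradiction s∈K r∉K
      ... | tri> _ _ r<s = contradiction (r<s , s-unskippable) (q-first (K<q s∈K))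

-- Complementation and reduction to an inner member

∁-involutive : (A : Subset n) → ∁ (∁ A) ≡ A
∁-involutive A = ⊆-antisym (x∉∁p⇒x∈p ∘ x∈∁p⇒x∉p) (x∉p⇒x∈∁p ∘ x∈p⇒x∉∁p)

-- The difference of two complements is the reversed difference of the sets, so complementing only
-- swaps the roles of the two sets in a forbidden pattern.
∁-ABAFree : {𝓕 : Hypergraph n} → ABAFree 𝓕 → ABAFree (map ∁ 𝓕)
∁-ABAFree aba A∈ B∈ x<y y<z x∈A x∉B z∈A z∉B y∈B y∉A
  with ∈-map⁻ ∁ A∈ | ∈-map⁻ ∁ B∈
... | _ , A′∈ , refl | _ , B′∈ , refl =
  aba B′∈ A′∈ x<y y<z (x∉∁p⇒x∈p x∉B) (x∈∁p⇒x∉p x∈A) (x∉∁p⇒x∈p z∉B) (x∈∁p⇒x∉p z∈A)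
      (x∉∁p⇒x∈p y∉A) (x∈∁p⇒x∉p y∈B)

three-hit : ∀ {m} {𝓕 𝒦 : Hypergraph (3 + m)} → ABAFree 𝓕 →
  (∀ {K} → K L.∈ 𝒦 → K L.∈ 𝓕 ⊎ ∁ K L.∈ 𝓕) → PairwiseIntersecting 𝒦 →
  ∃ λ x → ∃₂ λ y z → x < y × y < z × Hits x y z 𝒦
three-hit {m} {𝓕} {𝒦} aba halfplane intersecting
  with anyL? (λ K → ¬? (zero ∈? K) ×-dec ¬? (fromℕ _ ∈? K)) 𝒦
-- Here the first and last vertices already hit everything; `suc zero` is a filler, strictly between
-- them because there are at least three vertices.
... | no none = zero , suc zero , fromℕ _ , s≤s z≤n , s≤s (s≤s z≤n) ,
  λ K∈ 0∉K _ last∉K → none (L.lose K∈ (0∉K , last∉K))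
... | yes avoiding with L.find avoiding
... | A , A∈𝒦 , 0∉A , last∉A with halfplane A∈𝒦
... | inj₁ A∈𝓕 = zero , three-hit-of-inner aba halfplane intersecting A∈𝒦 A∈𝓕 0∉A last∉A
... | inj₂ ∁A∈𝓕 = zero ,
  three-hit-of-inner (∁-ABAFree aba) halfplane′ intersecting A∈𝒦 (∁-flip ∁A∈𝓕) 0∉A last∉A
  where
  ∁-flip : ∀ {K} → ∁ K L.∈ 𝓕 → K L.∈ map ∁ 𝓕
  ∁-flip {K} ∁K∈ = subst (L._∈ map ∁ 𝓕) (∁-involutive K) (∈-map⁺ ∁ ∁K∈)
  halfplane′ : ∀ {K} → K L.∈ 𝒦 → K L.∈ map ∁ 𝓕 ⊎ ∁ K L.∈ map ∁ 𝓕
  halfplane′ K∈ = [ inj₂ ∘ ∈-map⁺ ∁ , inj₁ ∘ ∁-flip ]′ (halfplane K∈)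

-- From covering pairs to intersecting complements

∪≢⊤⇒∁-intersect : (A B : Subset n) → A ∪ B ≢ ⊤ → ∃ λ p → p ∈ ∁ A × p ∈ ∁ B
∪≢⊤⇒∁-intersect {n} A B A∪B≢⊤
  with ¬∀⟶∃¬ n (_∈ A ∪ B) (_∈? A ∪ B) (λ all → A∪B≢⊤ (⊆-antisym ⊆⊤ λ {p} _ → all p))
... | p , p∉ = p , x∉p⇒x∈∁p (p∉ ∘ x∈p∪q⁺ ∘ inj₁) , x∉p⇒x∈∁p (p∉ ∘ x∈p∪q⁺ ∘ inj₂)

mainTheorem5 : (n : ℕ) → n ≥ 3 → (ℋ : Hypergraph n) → PseudoHalfplane ℋ →
    (∀ (x y z : Fin n) → x < y → y < z →
    ∃ λ H → H L.∈ ℋ × x ∈ H × y ∈ H × z ∈ H) →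
    ∃₂ λ H₁ H₂ → H₁ L.∈ ℋ × H₂ L.∈ ℋ × H₁ ∪ H₂ ≡ ⊤
mainTheorem5 _ (s≤s (s≤s (s≤s z≤n))) ℋ (𝓕 , aba , ℋ⊆) triples
  with anyL? (λ H₁ → anyL? (λ H₂ → (H₁ ∪ H₂) ≟ˢ ⊤) ℋ) ℋ
... | yes cover with L.find cover
... | H₁ , H₁∈ , cover₁ with L.find cover₁
... | H₂ , H₂∈ , eq = H₁ , H₂ , H₁∈ , H₂∈ , eq
mainTheorem5 _ (s≤s (s≤s (s≤s z≤n))) ℋ (𝓕 , aba , ℋ⊆) triples | no noCover
  -- Without a covering pair the complements of hyperedges pairwise intersect. A triple inside `H`
  -- is missed entirely by `∁ H`, so three vertices hitting all complements contradict `triples`.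
  with three-hit {𝒦 = map ∁ ℋ} aba halfplane intersecting
  where
  halfplane : ∀ {K} → K L.∈ map ∁ ℋ → K L.∈ 𝓕 ⊎ ∁ K L.∈ 𝓕
  halfplane K∈ with ∈-map⁻ ∁ K∈
  ... | H , H∈ , refl with ℋ⊆ H∈
  ... | inj₁ H∈𝓕 = inj₂ (subst (L._∈ 𝓕) (sym (∁-involutive H)) H∈𝓕)
  ... | inj₂ (F , F∈𝓕 , refl) = inj₁ (subst (L._∈ 𝓕) (sym (∁-involutive F)) F∈𝓕)
  intersecting : PairwiseIntersecting (map ∁ ℋ)
  intersecting A∈ B∈ with ∈-map⁻ ∁ A∈ | ∈-map⁻ ∁ B∈
  ... | H₁ , H₁∈ , refl | H₂ , H₂∈ , refl =
    ∪≢⊤⇒∁-intersect H₁ H₂ λ eq → noCover (L.lose H₁∈ (L.lose H₂∈ eq))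
... | x , y , z , x<y , y<z , hits with triples x y z x<y y<z
... | H , H∈ , x∈H , y∈H , z∈H =
  ⊥-elim (hits (∈-map⁺ ∁ H∈) (x∈p⇒x∉∁p x∈H) (x∈p⇒x∉∁p y∈H) (x∈p⇒x∉∁p z∈H))
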